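{- Let $X_1,X_2$ be pointed types with $X_2$ homogeneous, let $f_1,f_2:X_1\to_\ast X_2$ be pointed maps, and let $(H_1,\kappa_1),(H_2,\kappa_2):f_1\sim_\ast f_2$ be pointed homotopies. If $H_1\sim H_2$, then there is a double pointed homotopy $(H_1,\kappa_1)\sim_\ast^2(H_2,\kappa_2)$.
   Context: Everything is inside Book HoTT; $p\cdot q$ is path concatenation, $\mathsf{ap}_f$ the action of $f$ on paths. $f\sim g$ denotes the type $\prod_x f(x)=g(x)$ of homotopies (also for dependent functions, so $H_1\sim H_2$ means $\prod_x H_1(x)=H_2(x)$). For a pointed type $X$, $\mathsf{pt}(X)$ is its basepoint; for a pointed map $f$, $\mathsf{fun}(f)$ is the underlying function and $\mathsf{bp}(f)$ the path witnessing basepoint preservation. A pointed type $(X,x_0)$ is homogeneous if it is equipped with a pointed equivalence $(X,x_0)\simeq_\ast(X,x)$ for every $x:X$. A pointed homotopy $f_1\sim_\ast f_2$ between pointed maps $f_1,f_2:X_1\to_\ast X_2$ is a pair $(H,\kappa)$ with $H:\mathsf{fun}(f_1)\sim\mathsf{fun}(f_2)$ and $\kappa:H(\mathsf{pt}(X_1))\cdot\mathsf{bp}(f_2)=\mathsf{bp}(f_1)$. A double pointed homotopy $(H_1,\kappa_1)\sim_\ast^2(H_2,\kappa_2)$ is a pair consisting of $\mu:H_1\sim H_2$ and a path $\mathsf{ap}_{ -\cdot\mathsf{bp}(f_2)}(\mu(\mathsf{pt}(X_1)))\cdot\kappa_2=\kappa_1$. (The component $\mu$ need not be the given homotopy $H_1\sim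 H_2$.) -}

{-# OPTIONS --without-K #-}
-- Without K, _≡_ serves as the identity type of HoTT.  Under K the coherence
-- components (the κ's and the 2-dimensional paths) would carry no content.
module Defs where

open import Level using (Level; _⊔_) renaming (suc to lsuc)
open import Function.Properties.Inverse.HalfAdjointEquivalence using (_≃_)
open import Relation.Binary.PropositionalEquality using (_≡_; trans; cong)

private
  variable
    a b : Level

infix 4 _∼_ _∼∗_ _∼∗²_
infix 3 _≃∗_
infixr 0 _→∗_

-- The library's _≗_ covers non-dependent functions only; homotopies between
-- homotopies need the dependent version.
_∼_ : {A : Set a} {B : A → Set b} (f g : (x : A) → B x) → Set (a ⊔ b)
f ∼ g = ∀ x → f x ≡ g x

record PointedType (a : Level) : Set (lsuc a) where
  constructor _,∗_
  field
    ty : Set a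
    pt : ty

open PointedType public

record _→∗_ (X : PointedType a) (Y : PointedType b) : Set (a ⊔ b) where
  constructor _,∗_
  field
    fun : ty X → ty Y
    bp  : fun (pt X) ≡ pt Y

open _→∗_ public

-- _≃_ is the library's half adjoint equivalence, so being an equivalence is
-- a proposition (given function extensionality), as in the HoTT book.
record _≃∗_ (X : PointedType a) (Y : PointedType b) : Set (a ⊔ b) where
  constructor _,∗_
  field
    equiv    : ty X ≃ ty Y
    equiv-bp : _≃_.to equiv (pt X) ≡ pt Y

open _≃∗_ public

-- This is structure on X, not a mere property: nothing is truncated.
Homogeneous : PointedType a → Set a
Homogeneous X = (x : ty X) → X ≃∗ (ty X ,∗ x)

record _∼∗_ {X₁ : PointedType a} {X₂ : PointedType b}
            (f₁ f₂ : X₁ →∗ X₂) : Set (a ⊔ b) where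
  constructor _,∗_
  field
    htpy : fun f₁ ∼ fun f₂
    coh  : trans (htpy (pt X₁)) (bp f₂) ≡ bp f₁

open _∼∗_ public

record _∼∗²_ {X₁ : PointedType a} {X₂ : PointedType b} {f₁ f₂ : X₁ →∗ X₂}
             (H₁ H₂ : f₁ ∼∗ f₂) : Set (a ⊔ b) where
  constructor _,∗_
  field
    htpy² : htpy H₁ ∼ htpy H₂
    coh²  : trans (cong (λ p → trans p (bp f₂)) (htpy² (pt X₁))) (coh H₂)
            ≡ coh H₁

open _∼∗²_ public

{-# OPTIONS --safe #-}
{-# OPTIONS --without-K #-}
-- The coherences κ₁ and κ₂ determine a path δ : H₁ pt ≡ H₂ pt which μ must take
-- at the basepoint, whereas the given ν : H₁ ∼ H₂ may differ from δ there by a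
-- loop.  By homogeneity of X₂ the loops on any path H₂ x are equivalent to
-- Ω²(X₂), so the loop ν(pt)⁻¹ · δ extends to a family of loops on all H₂ x, and
-- ν is corrected by that family.
module Submission where

open import Function.Base using (_∘_)
open import Function.Bundles using (mk↔ₛ′)
open import Function.Properties.Inverse.HalfAdjointEquivalence using (_≃_; ↔⇒≃)
open import Level using (Level)
open import Relation.Binary.PropositionalEquality
  using (_≡_; refl; sym; trans; cong; cong₂; cong-∘; trans-assoc; trans-reflʳ;
         trans-symˡ; trans-symʳ; module ≡-Reasoning)

open import Defs

private
  variable
    a b : Level
    A B : Set a

cong-conjugate : ∀ (f : A → B) {w x y z} (p : x ≡ w) (q : x ≡ y) (r : y ≡ z) →
                 cong f (trans (sym p) (trans q r)) ≡
                 trans (sym (cong f p)) (trans (cong f q) (cong f r))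
cong-conjugate f refl refl r = refl

-- Naturality of `f≡id` along `p`, solved for `p`.
conjugate-cong-≡id : {f : A → A} (f≡id : ∀ x → f x ≡ x) {x y : A} (p : x ≡ y) →
                     trans (sym (f≡id x)) (trans (cong f p) (f≡id y)) ≡ p
conjugate-cong-≡id f≡id {x} refl = trans-symˡ (f≡id x)

cong-≃ : (e : A ≃ B) {x y : A} → (x ≡ y) ≃ (_≃_.to e x ≡ _≃_.to e y)
cong-≃ e {x} {y} = ↔⇒≃ (mk↔ₛ′ (cong to) uncong cong-uncong uncong-cong)
  where
  open _≃_ e
  open ≡-Reasoning

  uncong : to x ≡ to y → x ≡ y
  uncong q = trans (sym (left-inverse-of x)) (trans (cong from q) (left-inverse-of y))

  cong-uncong : ∀ q → cong to (uncong q) ≡ q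
  cong-uncong q = begin
    cong to (uncong q)
      ≡⟨ cong-conjugate to (left-inverse-of x) (cong from q) (left-inverse-of y) ⟩
    trans (sym (cong to (left-inverse-of x)))
          (trans (cong to (cong from q)) (cong to (left-inverse-of y)))
      -- The half adjoint coherence turns the conjugating paths into values of `right-inverse-of`,
      -- so that naturality applies.
      ≡⟨ cong₂ (λ l r → trans (sym l) (trans (cong to (cong from q)) r))
               (left-right x) (left-right y) ⟩
    trans (sym (right-inverse-of (to x)))
          (trans (cong to (cong from q)) (right-inverse-of (to y)))
      ≡⟨ cong (λ c → trans (sym (right-inverse-of (to x))) (trans c (right-inverse-of (to y))))
              (sym (cong-∘ q)) ⟩
    trans (sym (right-inverse-of (to x)))
          (trans (cong (to ∘ from) q) (right-inverse-of (to y)))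
      ≡⟨ conjugate-cong-≡id right-inverse-of q ⟩
    q ∎

  uncong-cong : ∀ p → uncong (cong to p) ≡ p
  uncong-cong refl = trans-symˡ (left-inverse-of x)

trans-≃ : {x y z : A} (r : y ≡ z) → (x ≡ y) ≃ (x ≡ z)
trans-≃ r = ↔⇒≃ (mk↔ₛ′ (λ p → trans p r) (λ q → trans q (sym r))
  (λ q → trans (trans-assoc q) (trans (cong (trans q) (trans-symˡ r)) (trans-reflʳ q)))
  (λ p → trans (trans-assoc p) (trans (cong (trans p) (trans-symʳ r)) (trans-reflʳ p))))

-- Once the pointing path is `refl`, applying `cong` twice suffices: `cong` takes `refl` to `refl`
-- by computation, so the endpoints match.
Ω²-≃ : (e : A ≃ B) {x : A} {y : B} → _≃_.to e x ≡ y →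
       (refl {x = x} ≡ refl) ≃ (refl {x = y} ≡ refl)
Ω²-≃ e refl = cong-≃ (cong-≃ e)

-- Path induction reduces `p` to `refl` at `y`, where the pointed equivalence from `pt X` to `y`
-- acts on double loops.
homogeneous⇒Ω²≃loops : (X : PointedType a) → Homogeneous X → {y z : ty X} (p : y ≡ z) →
                       (refl {x = pt X} ≡ refl) ≃ (p ≡ p)
homogeneous⇒Ω²≃loops X hom {y} refl = Ω²-≃ (equiv (hom y)) (equiv-bp (hom y))

trans-trans-symˡ : {x y z : A} (p : x ≡ y) (q : x ≡ z) → trans p (trans (sym p) q) ≡ q
trans-trans-symˡ refl q = refl

trans-symʳ-cancel : {x y z : A} (p : x ≡ y) (q : z ≡ y) → trans (trans p (sym q)) q ≡ p
trans-symʳ-cancel p refl = trans (trans-reflʳ _) (trans-reflʳ p)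

lemma6p3 : ∀ {a b} (X₁ : PointedType a) (X₂ : PointedType b) →
    Homogeneous X₂ →
    (f₁ f₂ : X₁ →∗ X₂) (H₁ H₂ : f₁ ∼∗ f₂) →
    htpy H₁ ∼ htpy H₂ →
    H₁ ∼∗² H₂
lemma6p3 X₁ X₂ hom f₁ f₂ H₁ H₂ ν = μ ,∗ coh-μ
  where
  open ≡-Reasoning

  -- `W.to` is the map applied to `htpy²` in `coh²`; inverting it solves that equation for the value
  -- at the basepoint.
  module W = _≃_ (cong-≃ (trans-≃ (bp f₂)) {htpy H₁ (pt X₁)} {htpy H₂ (pt X₁)})
  module L x = _≃_ (homogeneous⇒Ω²≃loops X₂ hom (htpy H₂ x))

  δ : htpy H₁ (pt X₁) ≡ htpy H₂ (pt X₁)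
  δ = W.from (trans (coh H₁) (sym (coh H₂)))

  -- The discrepancy between `ν` and `δ`, moved to the basepoint of `X₂`, where it can be sent on to
  -- every `x`.
  ω : refl {x = pt X₂} ≡ refl
  ω = L.from (pt X₁) (trans (sym (ν (pt X₁))) δ)

  μ : htpy H₁ ∼ htpy H₂
  μ x = trans (ν x) (L.to x ω)

  μ-pt : μ (pt X₁) ≡ δ
  -- At `pt X₁` the transfer of `ω` undoes its definition, and `ν` cancels.
  μ-pt = trans (cong (trans (ν (pt X₁))) (L.right-inverse-of (pt X₁) _))
               (trans-trans-symˡ (ν (pt X₁)) δ)

  coh-μ : trans (W.to (μ (pt X₁))) (coh H₂) ≡ coh H₁
  coh-μ = begin
    trans (W.to (μ (pt X₁))) (coh H₂)
      ≡⟨ cong (λ p → trans (W.to p) (coh H₂)) μ-pt ⟩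
    trans (W.to δ) (coh H₂)
      ≡⟨ cong (λ p → trans p (coh H₂)) (W.right-inverse-of _) ⟩
    trans (trans (coh H₁) (sym (coh H₂))) (coh H₂)
      ≡⟨ trans-symʳ-cancel (coh H₁) (coh H₂) ⟩
    coh H₁ ∎
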